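{- Let $M\ge1$ and $\ell\ge 1$ be integers, let $\tau_0\cdots\tau_{\ell-1}\in\{0,\ldots,M\}^{\ell}$ be a finite word, and let $(\tau_i)_{i=0}^\infty$ be the infinite sequence obtained by the recursive formula $$\tau_{2^n\ell}\cdots\tau_{2^{n+1}\ell-1}:=\overline{\tau_0\cdots\tau_{2^n\ell-1}},\quad n=0,1,\ldots.$$ Then every finite (nonempty) word $\delta$ in $(\tau_i)_{i=0}^{\infty}$ has a density $$d(\delta):=\lim_{r\to\infty}\frac{N^{\delta}(\tau_0\cdots\tau_{r-1})}{r}.$$ Moreover, for every integer $n\ge 0$ satisfying $4^n\ell\ge |\delta|-1$ we have $$d(\delta)=d(\overline{\delta})=\frac{P-N}{6\cdot 4^n\ell}$$ with $$N=N^\delta(\tau_0\cdots\tau_{4^n\ell-1})+N^{\overline{\delta}}(\tau_0\cdots\tau_{4^n\ell-1})$$ and $$P=N^\delta(\tau_0\cdots\tau_{4^{n+1}\ell-1})+N^{\overline{\delta}}(\tau_0\cdots\tau_{4^{n+1}\ell-1}).$$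
   Context: The reflection of a word $w=c_1\cdots c_n$ over the alphabet $\{0,\ldots,M\}$ is $\overline{w}=(M-c_1)\cdots(M-c_n)$. $|\delta|$ denotes the length of the word $\delta$. $N^\delta(\epsilon)$ denotes the number of (possibly overlapping) occurrences of the word $\delta$ as a block of consecutive letters in the word $\epsilon$ (it is $0$ if $|\delta|>|\epsilon|$). $d(\overline\delta)$ is defined by the same limit formula as $d(\delta)$, with $\overline\delta$ in place of $\delta$. -}

module Defs where

open import Data.Fin using (Fin; opposite)
open import Data.Fin.Properties using (_≟_)
open import Data.Integer using (+_)
open import Data.List using (List; applyUpTo; filter; length; map; tails)
open import Data.List.Relation.Binary.Prefix.Heterogeneous using (Prefix)
open import Data.List.Relation.Binary.Prefix.Heterogeneous.Properties using (prefix?)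
open import Data.Nat using (ℕ; suc; _+_; _*_; _∸_; _^_; _≤_; NonZero)
open import Data.Nat.Properties using (m*n≢0; m^n≢0)
open import Data.Product using (∃-syntax)
open import Data.Rational as ℚ using (ℚ; 0ℚ; _/_; ∣_∣)
open import Data.Vec using (Vec; toList)
open import Relation.Binary.PropositionalEquality using (_≡_)

Letter : ℕ → Set
Letter M = Fin (suc M)

Word : ℕ → Set
Word M = List (Letter M)

Sequence : ℕ → Set
Sequence M = ℕ → Letter M

reflect : ∀ {M} → Word M → Word M
reflect = map opposite

-- The half-open block τ_a ⋯ τ_{b-1}, empty when b ≤ a.
segment : ∀ {M} → Sequence M → ℕ → ℕ → Word M
segment τ a b = applyUpTo (λ j → τ (a + j)) (b ∸ a)

-- The two equations determine τ uniquely when ℓ ≥ 1: the blocks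
-- [2ⁿℓ, 2ⁿ⁺¹ℓ) partition the indices from ℓ onwards.
record GeneratedBy {M ℓ : ℕ} (w : Vec (Letter M) ℓ) (τ : Sequence M) : Set where
  field
    initial   : segment τ 0 ℓ ≡ toList w
    recursive : ∀ n → segment τ (2 ^ n * ℓ) (2 ^ (n + 1) * ℓ)
                    ≡ reflect (segment τ 0 (2 ^ n * ℓ))

_OccursIn_ : ∀ {M} → Word M → Sequence M → Set
δ OccursIn τ = ∃[ a ] ∃[ b ] segment τ a b ≡ δ

-- An occurrence of δ in ε is a suffix of ε that starts with δ.
-- Intended for nonempty δ.
occurrences : ∀ {M} → Word M → Word M → ℕ
occurrences δ ε = length (filter (prefix? _≟_ δ) (tails ε))

-- Convergence as r → ∞ of a sequence indexed by the positive integers.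
_⟶_ : ((r : ℕ) → .{{NonZero r}} → ℚ) → ℚ → Set
f ⟶ L = ∀ (ε : ℚ) → 0ℚ ℚ.< ε →
  ∃[ R ] (∀ (r : ℕ) → .{{_ : NonZero r}} → R ≤ r → ∣ f r ℚ.- L ∣ ℚ.< ε)

HasDensity : ∀ {M} → Sequence M → Word M → ℚ → Set
HasDensity τ δ d = (λ r → + occurrences δ (segment τ 0 r) / r) ⟶ d

6*4^n*ℓ≢0 : ∀ n ℓ → .{{NonZero ℓ}} → NonZero (6 * 4 ^ n * ℓ)
6*4^n*ℓ≢0 n ℓ = m*n≢0 (6 * 4 ^ n) ℓ {{m*n≢0 6 (4 ^ n) {{_}} {{m^n≢0 4 n}}}}

{-# OPTIONS --safe #-}

-- The block A_m = τ_0 ⋯ τ_{2^m ℓ - 1} satisfies A_{m+1} = A_m Ā_m.  Let S_m be the number of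
-- occurrences of δ in A_m plus the number in Ā_m.  An occurrence of δ in a product of blocks at
-- least |δ| - 1 long meets at most two consecutive blocks, so inclusion-exclusion gives
--   S_{m+3} + 2 S_m = S_{m+1} + 2 S_{m+2},
-- that is, D_m = S_{m+2} - S_m doubles when m grows by one, as does the length of A_m.  Hence
-- d = D_m / (6 |A_m|) does not depend on m.  Moreover A_{m+1} and Ā_{m+1} each contain
-- S_m + O(|δ|) = D_{m+1} / 6 + O(|δ|) occurrences of δ, so the discrepancy
-- N^δ(τ_0 ⋯ τ_{r-1}) - r d is bounded for r = |A_m|.  A prefix of length 2^j ℓ + r with r ≤ 2^j ℓ
-- is A_j followed by the reflection of the prefix of length r, so that splitting off one block
-- changes the discrepancy by O(|δ|) only; it is therefore o(r).
module Submission where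

open import Data.Bool using (Bool; true; false; not; if_then_else_)
open import Data.Bool.Properties using (not-involutive)
open import Data.Fin using (Fin; opposite)
open import Data.Fin.Properties using (_≟_; opposite-involutive)
open import Data.Integer as ℤ using (ℤ; +_; +[1+_]; -[1+_])
import Data.Integer.Properties as ℤ
import Data.Integer.Tactic.RingSolver as ℤ-Solver
open import Data.List using ([]; _∷_; _++_; length; applyUpTo)
open import Data.List.Properties
  using (++-assoc; length-map; length-applyUpTo; length-++; map-++; map-∘; map-id; map-cong;
         map-applyUpTo; ∷-injective)
open import Data.List.Relation.Binary.Prefix.Heterogeneous as Prefix using (Prefix; []; _∷_)
open import Data.List.Relation.Binary.Prefix.Heterogeneous.Properties
  using (prefix?; map⁺; map⁻; length-mono)
open import Data.Nat
  using (ℕ; zero; suc; _+_; _*_; _∸_; _^_; _≤_; _<_; _≥_; NonZero; z≤n; s≤s; s≤s⁻¹; _≤?_)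
open import Data.Nat.Properties hiding (_≟_; _≤?_)
open import Data.Nat.Tactic.RingSolver using (solve-∀)
open import Data.Product using (_×_; _,_; ∃-syntax)
open import Data.Rational as ℚ using (ℚ; mkℚ; _/_)
import Data.Rational.Properties as ℚ
open import Data.Rational.Unnormalised as ℚᵘ using (mkℚᵘ)
import Data.Rational.Unnormalised.Properties as ℚᵘ
open import Data.Vec using (Vec)
open import Function using (_∘_; mk⇔; _⇔_)
open import Relation.Binary.PropositionalEquality
open import Relation.Nullary using (does; yes; no; contradiction)
open import Relation.Nullary.Decidable using (does-⇔; dec-false)
open import Defs

-- Occurrences in concatenations

startsWith : ∀ {M} → Word M → Word M → ℕ
startsWith δ ε = if does (prefix? _≟_ δ ε) then 1 else 0

startsWith≤1 : ∀ {M} (δ ε : Word M) → startsWith δ ε ≤ 1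
startsWith≤1 δ ε with does (prefix? _≟_ δ ε)
... | true  = ≤-refl
... | false = z≤n

startsWith-⇔ : ∀ {M} (δ ε δ′ ε′ : Word M) → Prefix _≡_ δ ε ⇔ Prefix _≡_ δ′ ε′ →
  startsWith δ ε ≡ startsWith δ′ ε′
startsWith-⇔ δ ε δ′ ε′ p⇔ =
  cong (if_then 1 else 0) (does-⇔ p⇔ (prefix? _≟_ δ ε) (prefix? _≟_ δ′ ε′))

occurrences-∷ : ∀ {M} (δ : Word M) x ε →
  occurrences δ (x ∷ ε) ≡ startsWith δ (x ∷ ε) + occurrences δ ε
occurrences-∷ δ x ε with does (prefix? _≟_ δ (x ∷ ε))
... | true  = refl
... | false = refl

-- Nonemptiness of `δ` enters here: `tails []` still contains one empty word, in which an empty `δ`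
-- would be counted once.
occurrences-[] : ∀ {M} {δ : Word M} → δ ≢ [] → occurrences δ [] ≡ 0
occurrences-[] {δ = []}    δ≢[] = contradiction refl δ≢[]
occurrences-[] {δ = _ ∷ _} _    = refl

prefix-++⁺ : ∀ {M} {δ ε : Word M} ζ → Prefix _≡_ δ ε → Prefix _≡_ δ (ε ++ ζ)
prefix-++⁺ ζ []       = []
prefix-++⁺ ζ (e ∷ es) = e ∷ prefix-++⁺ ζ es

prefix-++⁻ : ∀ {M} {δ} (ε : Word M) ζ → length δ ≤ length ε →
  Prefix _≡_ δ (ε ++ ζ) → Prefix _≡_ δ ε
prefix-++⁻ {δ = []}    ε       ζ δ≤ε _        = []
prefix-++⁻ {δ = _ ∷ _} (_ ∷ ε) ζ δ≤ε (e ∷ es) = e ∷ prefix-++⁻ ε ζ (s≤s⁻¹ δ≤ε) es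

startsWith-++ : ∀ {M} δ (ε : Word M) ζ → length δ ≤ length ε →
  startsWith δ (ε ++ ζ) ≡ startsWith δ ε
startsWith-++ δ ε ζ δ≤ε = startsWith-⇔ δ (ε ++ ζ) δ ε
  (mk⇔ (prefix-++⁻ ε ζ δ≤ε) (prefix-++⁺ ζ))

opposite-injective : ∀ {n} {i j : Fin n} → opposite i ≡ opposite j → i ≡ j
opposite-injective {i = i} {j} eq =
  trans (sym (opposite-involutive i)) (trans (cong opposite eq) (opposite-involutive j))

startsWith-reflect : ∀ {M} (δ ε : Word M) →
  startsWith (reflect δ) (reflect ε) ≡ startsWith δ ε
startsWith-reflect δ ε = startsWith-⇔ (reflect δ) (reflect ε) δ ε (mk⇔
  (Prefix.map opposite-injective ∘ map⁻ opposite opposite)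
  (map⁺ opposite opposite ∘ Prefix.map (cong opposite)))

reflect-involutive : ∀ {M} (ε : Word M) → reflect (reflect ε) ≡ ε
reflect-involutive ε =
  trans (sym (map-∘ ε)) (trans (map-cong opposite-involutive ε) (map-id ε))

reflect-≢[] : ∀ {M} {δ : Word M} → δ ≢ [] → reflect δ ≢ []
reflect-≢[] {δ = []} δ≢[] = δ≢[]

occurrences-reflect : ∀ {M} (δ : Word M) → δ ≢ [] → ∀ ε →
  occurrences (reflect δ) (reflect ε) ≡ occurrences δ ε
occurrences-reflect δ δ≢[] [] =
  trans (occurrences-[] (reflect-≢[] δ≢[])) (sym (occurrences-[] δ≢[]))
occurrences-reflect δ δ≢[] (x ∷ ε) = begin
  occurrences (reflect δ) (reflect (x ∷ ε))
    ≡⟨ occurrences-∷ (reflect δ) _ _ ⟩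
  startsWith (reflect δ) (reflect (x ∷ ε)) + occurrences (reflect δ) (reflect ε)
    ≡⟨ cong₂ _+_ (startsWith-reflect δ (x ∷ ε)) (occurrences-reflect δ δ≢[] ε) ⟩
  startsWith δ (x ∷ ε) + occurrences δ ε
    ≡⟨ occurrences-∷ δ x ε ⟨
  occurrences δ (x ∷ ε) ∎
  where open ≡-Reasoning

-- An occurrence of δ in ε v ζ lies in ε v or in v ζ, and in both exactly when it lies in v.
occurrences-overlap : ∀ {M} (δ : Word M) ε v ζ → length δ ∸ 1 ≤ length v →
  occurrences δ (ε ++ v ++ ζ) + occurrences δ v ≡
  occurrences δ (ε ++ v) + occurrences δ (v ++ ζ)
occurrences-overlap δ [] v ζ δ≤ = +-comm (occurrences δ (v ++ ζ)) _
occurrences-overlap δ (x ∷ ε) v ζ δ≤ = begin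
  occurrences δ (x ∷ ε ++ v ++ ζ) + occurrences δ v
    ≡⟨ cong (_+ occurrences δ v) (occurrences-∷ δ x (ε ++ v ++ ζ)) ⟩
  startsWith δ (x ∷ ε ++ v ++ ζ) + occurrences δ (ε ++ v ++ ζ) + occurrences δ v
    ≡⟨ +-assoc (startsWith δ (x ∷ ε ++ v ++ ζ)) _ _ ⟩
  startsWith δ (x ∷ ε ++ v ++ ζ) + (occurrences δ (ε ++ v ++ ζ) + occurrences δ v)
    ≡⟨ cong₂ _+_ starts (occurrences-overlap δ ε v ζ δ≤) ⟩
  startsWith δ (x ∷ ε ++ v) + (occurrences δ (ε ++ v) + occurrences δ (v ++ ζ))
    ≡⟨ +-assoc (startsWith δ (x ∷ ε ++ v)) _ _ ⟨
  startsWith δ (x ∷ ε ++ v) + occurrences δ (ε ++ v) + occurrences δ (v ++ ζ)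
    ≡⟨ cong (_+ occurrences δ (v ++ ζ)) (occurrences-∷ δ x (ε ++ v)) ⟨
  occurrences δ (x ∷ ε ++ v) + occurrences δ (v ++ ζ) ∎
  where
  open ≡-Reasoning
  v≤ε++v : ∀ (ε : Word _) → length v ≤ length (ε ++ v)
  v≤ε++v []      = ≤-refl
  v≤ε++v (_ ∷ ε) = m≤n⇒m≤1+n (v≤ε++v ε)
  -- The letter `x` makes up for the one letter by which `v` may be shorter than `δ`, so whether `δ`
  -- starts at `x` is decided before `ζ` begins.
  long : length δ ≤ length (x ∷ ε ++ v)
  long = ≤-trans (m≤n+m∸n (length δ) 1) (s≤s (≤-trans δ≤ (v≤ε++v ε)))
  starts : startsWith δ (x ∷ ε ++ v ++ ζ) ≡ startsWith δ (x ∷ ε ++ v)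
  starts = trans (cong (startsWith δ ∘ (x ∷_)) (sym (++-assoc ε v ζ)))
                 (startsWith-++ δ (x ∷ ε ++ v) ζ long)

occurrences-++-length : ∀ {M} (δ : Word M) ε ζ →
  occurrences δ (ε ++ ζ) ≤ length ε + occurrences δ ζ
occurrences-++-length δ []      ζ = ≤-refl
occurrences-++-length δ (x ∷ ε) ζ = begin
  occurrences δ (x ∷ ε ++ ζ)                         ≡⟨ occurrences-∷ δ x (ε ++ ζ) ⟩
  startsWith δ (x ∷ ε ++ ζ) + occurrences δ (ε ++ ζ)
    ≤⟨ +-mono-≤ (startsWith≤1 δ (x ∷ ε ++ ζ)) (occurrences-++-length δ ε ζ) ⟩
  suc (length ε + occurrences δ ζ)                   ∎
  where open ≤-Reasoning

occurrences-≤-length : ∀ {M} (δ : Word M) → δ ≢ [] → ∀ ε → occurrences δ ε ≤ length ε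
occurrences-≤-length δ δ≢[] []      = ≤-reflexive (occurrences-[] δ≢[])
occurrences-≤-length δ δ≢[] (x ∷ ε) = begin
  occurrences δ (x ∷ ε)                    ≡⟨ occurrences-∷ δ x ε ⟩
  startsWith δ (x ∷ ε) + occurrences δ ε
    ≤⟨ +-mono-≤ (startsWith≤1 δ (x ∷ ε)) (occurrences-≤-length δ δ≢[] ε) ⟩
  suc (length ε)                           ∎
  where open ≤-Reasoning

occurrences-short : ∀ {M} (δ : Word M) → δ ≢ [] → ∀ ε →
  length ε < length δ → occurrences δ ε ≡ 0
occurrences-short δ δ≢[] [] ε<δ = occurrences-[] δ≢[]
occurrences-short δ δ≢[] (x ∷ ε) ε<δ = begin
  occurrences δ (x ∷ ε)                  ≡⟨ occurrences-∷ δ x ε ⟩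
  startsWith δ (x ∷ ε) + occurrences δ ε
    ≡⟨ cong₂ _+_ (cong (if_then 1 else 0)
                   (dec-false (prefix? _≟_ δ (x ∷ ε)) (<⇒≱ ε<δ ∘ length-mono)))
                 (occurrences-short δ δ≢[] ε (<-trans (n<1+n _) ε<δ)) ⟩
  0 ∎
  where open ≡-Reasoning

-- The number `c` counts the occurrences that straddle the border. Letters are removed from the
-- front of `ε` as long as the word is at least as long as `δ`, since then `ζ` cannot affect whether
-- `δ` starts there. A shorter word contains no occurrence and has fewer than `length δ` letters at
-- which one could start.
occurrences-++ : ∀ {M} (δ : Word M) → δ ≢ [] → ∀ ε ζ →
  ∃[ c ] (c ≤ length δ × occurrences δ (ε ++ ζ) ≡ occurrences δ ε + occurrences δ ζ + c)
occurrences-++ δ δ≢[] [] ζ =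
  0 , z≤n , sym (trans (+-identityʳ _) (cong (_+ occurrences δ ζ) (occurrences-[] δ≢[])))
occurrences-++ δ δ≢[] (x ∷ ε) ζ with length δ ≤? length (x ∷ ε)
... | yes δ≤ =
  let c , c≤ , eq = occurrences-++ δ δ≢[] ε ζ in
  c , c≤ , (begin
    occurrences δ (x ∷ ε ++ ζ)                         ≡⟨ occurrences-∷ δ x (ε ++ ζ) ⟩
    startsWith δ (x ∷ ε ++ ζ) + occurrences δ (ε ++ ζ)
      ≡⟨ cong₂ _+_ (startsWith-++ δ (x ∷ ε) ζ δ≤) eq ⟩
    startsWith δ (x ∷ ε) + (occurrences δ ε + occurrences δ ζ + c)
      ≡⟨ assoc (startsWith δ (x ∷ ε)) (occurrences δ ε) (occurrences δ ζ) c ⟩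
    startsWith δ (x ∷ ε) + occurrences δ ε + occurrences δ ζ + c
      ≡⟨ cong (λ o → o + occurrences δ ζ + c) (occurrences-∷ δ x ε) ⟨
    occurrences δ (x ∷ ε) + occurrences δ ζ + c        ∎)
  where
  open ≡-Reasoning
  assoc : ∀ a b c d → a + (b + c + d) ≡ a + b + c + d
  assoc = solve-∀
... | no δ≰ =
  -- The truncated subtraction is exact, because prepending letters to `ζ` loses no occurrence
  -- (`suffix`).
  occurrences δ (x ∷ ε ++ ζ) ∸ occurrences δ ζ
  , ≤-trans (m≤n+o⇒m∸n≤o _ _ (≤-trans (occurrences-++-length δ (x ∷ ε) ζ)
                                      (≤-reflexive (+-comm (length (x ∷ ε)) _))))
            (<⇒≤ (≰⇒> δ≰))
  , sym (trans (cong (λ o → o + occurrences δ ζ +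
                            (occurrences δ (x ∷ ε ++ ζ) ∸ occurrences δ ζ))
                     (occurrences-short δ δ≢[] (x ∷ ε) (≰⇒> δ≰)))
               (m+[n∸m]≡n (suffix (x ∷ ε))))
  where
  suffix : ∀ ε → occurrences δ ζ ≤ occurrences δ (ε ++ ζ)
  suffix []      = ≤-refl
  suffix (y ∷ ε) = ≤-trans (≤-trans (suffix ε) (m≤n+m _ (startsWith δ (y ∷ ε ++ ζ))))
                           (≤-reflexive (sym (occurrences-∷ δ y (ε ++ ζ))))

-- Two uses of `occurrences-overlap`: the three consecutive pairs of blocks cover the word and
-- overlap in `y` and in `z`.
occurrences-four : ∀ {M} (δ x y z w : Word M) →
  length δ ∸ 1 ≤ length y → length δ ∸ 1 ≤ length z →
  occurrences δ ((x ++ y) ++ (z ++ w)) + (occurrences δ y + occurrences δ z) ≡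
  occurrences δ (x ++ y) + occurrences δ (y ++ z) + occurrences δ (z ++ w)
occurrences-four δ x y z w δ≤y δ≤z = begin
  o ((x ++ y) ++ (z ++ w)) + (o y + o z)  ≡⟨ cong (λ v → o v + (o y + o z)) (++-assoc x y (z ++ w)) ⟩
  o (x ++ y ++ z ++ w) + (o y + o z)      ≡⟨ +-assoc (o (x ++ y ++ z ++ w)) (o y) (o z) ⟨
  o (x ++ y ++ z ++ w) + o y + o z        ≡⟨ cong (_+ o z) (occurrences-overlap δ x y (z ++ w) δ≤y) ⟩
  o (x ++ y) + o (y ++ z ++ w) + o z      ≡⟨ +-assoc (o (x ++ y)) _ _ ⟩
  o (x ++ y) + (o (y ++ z ++ w) + o z)
    ≡⟨ cong (λ k → o (x ++ y) + k) (occurrences-overlap δ y z w δ≤z) ⟩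
  o (x ++ y) + (o (y ++ z) + o (z ++ w))  ≡⟨ +-assoc (o (x ++ y)) _ _ ⟨
  o (x ++ y) + o (y ++ z) + o (z ++ w)    ∎
  where
  open ≡-Reasoning
  o = occurrences δ

-- With a = A_m and b = Ā_m this is S_{m+3} + 2 S_m = S_{m+1} + 2 S_{m+2}.
occurrences-doubling : ∀ {M} (δ a b : Word M) →
  length δ ∸ 1 ≤ length a → length δ ∸ 1 ≤ length b →
  let o = occurrences δ
      p = a ++ b
      q = b ++ a in
  (o ((p ++ q) ++ (q ++ p)) + o ((q ++ p) ++ (p ++ q))) + 2 * (o a + o b) ≡
  (o p + o q) + 2 * (o (p ++ q) + o (q ++ p))
occurrences-doubling δ a b δ≤a δ≤b =
  linear (o a) (o b) (o p) (o q) (o (p ++ p)) (o (q ++ q)) (o (p ++ q)) (o (q ++ p))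
    (o ((p ++ q) ++ (q ++ p))) (o ((q ++ p) ++ (p ++ q)))
    -- The squares `p ++ p` and `q ++ q` are evaluated by the first two equations and appear as
    -- middle pairs in the last two. Adding all four eliminates them.
    (occurrences-four δ a b a b δ≤b δ≤a)
    (occurrences-four δ b a b a δ≤a δ≤b)
    (occurrences-four δ p q q p δ≤q δ≤q)
    (occurrences-four δ q p p q δ≤p δ≤p)
  where
  open ≡-Reasoning
  o = occurrences δ
  p = a ++ b
  q = b ++ a
  long : ∀ c d → length δ ∸ 1 ≤ length c → length δ ∸ 1 ≤ length (c ++ d)
  long c d δ≤c = ≤-trans δ≤c (≤-trans (m≤m+n (length c) (length d))
    (≤-reflexive (sym (length-++ c))))
  δ≤p = long a b δ≤a
  δ≤q = long b a δ≤b
  linear : ∀ a b p q pp qq pq qp x y →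
    pp + (b + a) ≡ p + q + p → qq + (a + b) ≡ q + p + q →
    x + (q + q) ≡ pq + qq + qp → y + (p + p) ≡ qp + pp + pq →
    x + y + 2 * (a + b) ≡ p + q + 2 * (pq + qp)
  linear a b p q pp qq pq qp x y e₁ e₂ e₃ e₄ = +-cancelʳ-≡ ((q + q) + (p + p)) _ _ (begin
    x + y + 2 * (a + b) + ((q + q) + (p + p))               ≡⟨ l₁ a b p q x y ⟩
    (x + (q + q)) + (y + (p + p)) + 2 * (a + b)             ≡⟨ cong₂ (λ u v → u + v + 2 * (a + b)) e₃ e₄ ⟩
    (pq + qq + qp) + (qp + pp + pq) + 2 * (a + b)           ≡⟨ l₂ a b pp qq pq qp ⟩
    2 * (pq + qp) + ((pp + (b + a)) + (qq + (a + b)))       ≡⟨ cong₂ (λ u v → 2 * (pq + qp) + (u + v)) e₁ e₂ ⟩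
    2 * (pq + qp) + ((p + q + p) + (q + p + q))             ≡⟨ l₃ p q pq qp ⟩
    p + q + 2 * (pq + qp) + ((q + q) + (p + p))             ∎)
    where
    l₁ : ∀ a b p q x y →
         x + y + 2 * (a + b) + ((q + q) + (p + p)) ≡
         (x + (q + q)) + (y + (p + p)) + 2 * (a + b)
    l₁ = solve-∀
    l₂ : ∀ a b pp qq pq qp →
         (pq + qq + qp) + (qp + pp + pq) + 2 * (a + b) ≡
         2 * (pq + qp) + ((pp + (b + a)) + (qq + (a + b)))
    l₂ = solve-∀
    l₃ : ∀ p q pq qp →
         2 * (pq + qp) + ((p + q + p) + (q + p + q)) ≡
         p + q + 2 * (pq + qp) + ((q + q) + (p + p))
    l₃ = solve-∀

-- Blocks of the sequence and their reflections

applyUpTo-+ : ∀ {A : Set} (f : ℕ → A) m n →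
  applyUpTo f (m + n) ≡ applyUpTo f m ++ applyUpTo (λ i → f (m + i)) n
applyUpTo-+ f zero    n = refl
applyUpTo-+ f (suc m) n = cong (f 0 ∷_) (applyUpTo-+ (f ∘ suc) m n)

applyUpTo-≡-≤ : ∀ {A : Set} (f g : ℕ → A) {m n} → m ≤ n →
  applyUpTo f n ≡ applyUpTo g n → applyUpTo f m ≡ applyUpTo g m
applyUpTo-≡-≤ f g z≤n       eq = refl
applyUpTo-≡-≤ f g (s≤s m≤n) eq with ∷-injective eq
... | f0≡g0 , eq′ = cong₂ _∷_ f0≡g0 (applyUpTo-≡-≤ (f ∘ suc) (g ∘ suc) m≤n eq′)

double : ∀ m n → 2 ^ suc m * n ≡ 2 ^ m * n + 2 ^ m * n
double m n = lemma (2 ^ m) n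
  where
  lemma : ∀ a b → 2 * a * b ≡ a * b + a * b
  lemma = solve-∀

-- This is `S_j`. The Boolean is `false` for the block itself and `true` for its reflection.
blockSum : (Bool → ℕ → ℕ) → ℕ → ℕ → ℕ
blockSum count ℓ j = count false (2 ^ j * ℓ) + count true (2 ^ j * ℓ)

-- Indexing by a Boolean treats a block and its reflection in one statement; reflecting once more
-- becomes `not`.
orient : ∀ {M} → Bool → Word M → Word M
orient false ε = ε
orient true  ε = reflect ε

orient-++-reflect : ∀ {M} b (ε ζ : Word M) →
  orient b (ε ++ reflect ζ) ≡ orient b ε ++ orient (not b) ζ
orient-++-reflect false ε ζ = refl
orient-++-reflect true  ε ζ =
  trans (map-++ opposite ε (reflect ζ)) (cong (reflect ε ++_) (reflect-involutive ζ))

length-orient : ∀ {M} b (ε : Word M) → length (orient b ε) ≡ length ε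
length-orient false ε = refl
length-orient true  ε = length-map opposite ε

module _ {M ℓ} {w} {τ : Sequence M} (gen : GeneratedBy {M} {ℓ} w τ) where
  open GeneratedBy gen

  -- The recursion is the case of the full block, `r = 2 ^ n * ℓ`; truncating both sides to their
  -- first `r` letters gives the others.
  prefix-split : ∀ n r → r ≤ 2 ^ n * ℓ →
    segment τ 0 (2 ^ n * ℓ + r) ≡ segment τ 0 (2 ^ n * ℓ) ++ reflect (segment τ 0 r)
  prefix-split n r r≤ = trans (applyUpTo-+ τ (2 ^ n * ℓ) r) (cong (segment τ 0 (2 ^ n * ℓ) ++_) (begin
    applyUpTo (λ i → τ (2 ^ n * ℓ + i)) r
      ≡⟨ applyUpTo-≡-≤ (λ i → τ (2 ^ n * ℓ + i)) (opposite ∘ τ) r≤ block ⟩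
    applyUpTo (opposite ∘ τ) r
      ≡⟨ map-applyUpTo τ opposite r ⟨
    reflect (applyUpTo τ r) ∎))
    where
    open ≡-Reasoning
    block-length : 2 ^ (n + 1) * ℓ ∸ 2 ^ n * ℓ ≡ 2 ^ n * ℓ
    block-length = begin
      2 ^ (n + 1) * ℓ ∸ 2 ^ n * ℓ           ≡⟨ cong (λ k → 2 ^ k * ℓ ∸ 2 ^ n * ℓ) (+-comm n 1) ⟩
      2 ^ suc n * ℓ ∸ 2 ^ n * ℓ             ≡⟨ cong (_∸ 2 ^ n * ℓ) (double n ℓ) ⟩
      2 ^ n * ℓ + 2 ^ n * ℓ ∸ 2 ^ n * ℓ     ≡⟨ m+n∸n≡m (2 ^ n * ℓ) (2 ^ n * ℓ) ⟩
      2 ^ n * ℓ                             ∎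
    block : applyUpTo (λ i → τ (2 ^ n * ℓ + i)) (2 ^ n * ℓ) ≡ applyUpTo (opposite ∘ τ) (2 ^ n * ℓ)
    block = begin
      applyUpTo (λ i → τ (2 ^ n * ℓ + i)) (2 ^ n * ℓ)
        ≡⟨ cong (applyUpTo (λ i → τ (2 ^ n * ℓ + i))) block-length ⟨
      segment τ (2 ^ n * ℓ) (2 ^ (n + 1) * ℓ)
        ≡⟨ recursive n ⟩
      reflect (segment τ 0 (2 ^ n * ℓ))
        ≡⟨ map-applyUpTo τ opposite (2 ^ n * ℓ) ⟩
      applyUpTo (opposite ∘ τ) (2 ^ n * ℓ) ∎

  orientedPrefix : Bool → ℕ → Word M
  orientedPrefix b r = orient b (segment τ 0 r)

  length-orientedPrefix : ∀ b r → length (orientedPrefix b r) ≡ r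
  length-orientedPrefix b r = trans (length-orient b (segment τ 0 r)) (length-applyUpTo τ r)

  orientedPrefix-split : ∀ b n r → r ≤ 2 ^ n * ℓ →
    orientedPrefix b (2 ^ n * ℓ + r) ≡ orientedPrefix b (2 ^ n * ℓ) ++ orientedPrefix (not b) r
  orientedPrefix-split b n r r≤ =
    trans (cong (orient b) (prefix-split n r r≤))
          (orient-++-reflect b (segment τ 0 (2 ^ n * ℓ)) (segment τ 0 r))

  orientedPrefix-double : ∀ b n →
    orientedPrefix b (2 ^ suc n * ℓ) ≡
    orientedPrefix b (2 ^ n * ℓ) ++ orientedPrefix (not b) (2 ^ n * ℓ)
  orientedPrefix-double b n =
    trans (cong (orientedPrefix b) (double n ℓ)) (orientedPrefix-split b n (2 ^ n * ℓ) ≤-refl)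

  -- Reflecting the prefix rather than `δ` keeps the counted word fixed, so that counts for both
  -- orientations can be added across a concatenation.
  prefixCount : Word M → Bool → ℕ → ℕ
  prefixCount δ b r = occurrences δ (orientedPrefix b r)

  prefixCount-≤ : ∀ δ → δ ≢ [] → ∀ b r → prefixCount δ b r ≤ r
  prefixCount-≤ δ δ≢[] b r =
    ≤-trans (occurrences-≤-length δ δ≢[] (orientedPrefix b r)) (≤-reflexive (length-orientedPrefix b r))

  prefixCount-split : ∀ δ → δ ≢ [] → ∀ b n r → r ≤ 2 ^ n * ℓ →
    ∃[ c ] (c ≤ length δ ×
      prefixCount δ b (2 ^ n * ℓ + r) ≡ prefixCount δ b (2 ^ n * ℓ) + prefixCount δ (not b) r + c)
  prefixCount-split δ δ≢[] b n r r≤ =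
    let c , c≤ , eq = occurrences-++ δ δ≢[] (orientedPrefix b (2 ^ n * ℓ))
                                            (orientedPrefix (not b) r) in
    c , c≤ , trans (cong (occurrences δ) (orientedPrefix-split b n r r≤)) eq

  -- Three unfoldings write the block of index `3 + n` as the Thue-Morse pattern `a b b a b a a b`
  -- in the block `a` of index `n` and its reflection `b`, and the reflected block as the
  -- complementary pattern. These are the words of `occurrences-doubling`.
  prefixCount-doubling : ∀ δ n → length δ ∸ 1 ≤ 2 ^ n * ℓ →
    let S = blockSum (prefixCount δ) ℓ in
    S (3 + n) + 2 * S n ≡ S (1 + n) + 2 * S (2 + n)
  prefixCount-doubling δ n δ≤ = begin
    S (3 + n) + 2 * S n ≡⟨ cong (_+ 2 * S n) (cong₂ _+_ (cong o (U₃ false)) (cong o (U₃ true))) ⟩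
    _                   ≡⟨ occurrences-doubling δ a b (long false) (long true) ⟩
    _                   ≡⟨ cong₂ (λ s t → s + 2 * t)
                             (cong₂ _+_ (cong o (U₁ false)) (cong o (U₁ true)))
                             (cong₂ _+_ (cong o (U₂ false)) (cong o (U₂ true))) ⟨
    S (1 + n) + 2 * S (2 + n) ∎
    where
    open ≡-Reasoning
    o = occurrences δ
    U = λ k b → orientedPrefix b (2 ^ k * ℓ)
    S = blockSum (prefixCount δ) ℓ
    a = U n false
    b = U n true
    long : ∀ c → length δ ∸ 1 ≤ length (U n c)
    long c = ≤-trans δ≤ (≤-reflexive (sym (length-orientedPrefix c (2 ^ n * ℓ))))
    U₁ : ∀ c → U (1 + n) c ≡ U n c ++ U n (not c)
    U₁ c = orientedPrefix-double c n
    U₂ : ∀ c → U (2 + n) c ≡ (U n c ++ U n (not c)) ++ (U n (not c) ++ U n c)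
    U₂ c = trans (orientedPrefix-double c (1 + n)) (cong₂ _++_ (U₁ c)
             (trans (U₁ (not c)) (cong (λ d → U n (not c) ++ U n d) (not-involutive c))))
    U₃ : ∀ c → U (3 + n) c ≡ ((U n c ++ U n (not c)) ++ (U n (not c) ++ U n c))
                          ++ ((U n (not c) ++ U n c) ++ (U n c ++ U n (not c)))
    U₃ c = trans (orientedPrefix-double c (2 + n)) (cong₂ _++_ (U₂ c)
             (trans (U₂ (not c))
               (cong (λ d → (U n (not c) ++ U n d) ++ (U n d ++ U n (not c))) (not-involutive c))))

-- Limits of sublinearly approximated counts

-- For `ε = p / q`, clearing denominators turns the goal into `q * |G f(r) - r D| < p r G`. As `p`
-- and `G` are at least 1, it suffices that the left side is below `r`, which is the hypothesis with
-- `c = q`.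
sublinear⇒⟶ : (f : ℕ → ℕ) (G : ℕ) .{{_ : NonZero G}} (D : ℤ) →
  (∀ c → ∃[ R ] (∀ r → R ≤ r → c * ℤ.∣ + G ℤ.* + f r ℤ.- + r ℤ.* D ∣ < r)) →
  (λ r → + f r ℚ./ r) ⟶ (D ℚ./ G)
sublinear⇒⟶ f (suc g) D small (mkℚ (+ zero) _ _) (ℚ.*<* (ℤ.+<+ ()))
sublinear⇒⟶ f (suc g) D small (mkℚ -[1+ _ ] _ _) (ℚ.*<* ())
sublinear⇒⟶ f (suc g) D small ε@(mkℚ (+[1+ p ]) q-1 _) _ =
  let R , small′ = small (suc q-1) in R , λ { (suc r) R≤r → close r (small′ (suc r) R≤r) }
  where
  G = suc g
  close : ∀ s → let r = suc s in
    suc q-1 * ℤ.∣ + G ℤ.* + f r ℤ.- + r ℤ.* D ∣ < r →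
    ℚ.∣ + f r ℚ./ r ℚ.- D ℚ./ G ∣ ℚ.< ε
  close s bound = ℚ.toℚᵘ-cancel-< (ℚᵘ.<-respˡ-≃ (ℚᵘ.≃-sym value) (ℚᵘ.*<* numerators))
    where
    r = suc s
    x = mkℚᵘ (+ f r) s
    y = mkℚᵘ D g
    value : ℚ.toℚᵘ ℚ.∣ + f r ℚ./ r ℚ.- D ℚ./ G ∣ ℚᵘ.≃ ℚᵘ.∣ x ℚᵘ.- y ∣
    value = ℚᵘ.≃-trans (ℚ.toℚᵘ-homo-∣-∣ (+ f r ℚ./ r ℚ.- D ℚ./ G)) (ℚᵘ.∣-∣-cong
      (ℚᵘ.≃-trans (ℚ.toℚᵘ-homo-+ (+ f r ℚ./ r) (ℚ.- (D ℚ./ G)))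
        (ℚᵘ.+-cong (ℚ.toℚᵘ-fromℚᵘ x)
          (ℚᵘ.≃-trans (ℚ.toℚᵘ-homo‿- (D ℚ./ G)) (ℚᵘ.-‿cong (ℚ.toℚᵘ-fromℚᵘ y))))))
    numerators : + ℤ.∣ + f r ℤ.* + G ℤ.+ (ℤ.- D) ℤ.* + r ∣ ℤ.* + suc q-1
           ℤ.< + suc p ℤ.* + (r * G)
    numerators = subst₂ ℤ._<_
      (ℤ.pos-* ℤ.∣ + f r ℤ.* + G ℤ.+ (ℤ.- D) ℤ.* + r ∣ (suc q-1))
      (ℤ.pos-* (suc p) (r * G)) (ℤ.+<+ (begin-strict
      ℤ.∣ + f r ℤ.* + G ℤ.+ (ℤ.- D) ℤ.* + r ∣ * suc q-1
        ≡⟨ *-comm ℤ.∣ + f r ℤ.* + G ℤ.+ (ℤ.- D) ℤ.* + r ∣ (suc q-1) ⟩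
      suc q-1 * ℤ.∣ + f r ℤ.* + G ℤ.+ (ℤ.- D) ℤ.* + r ∣
        ≡⟨ cong (λ i → suc q-1 * ℤ.∣ i ∣) (rearrange (+ f r) (+ G) D (+ r)) ⟩
      suc q-1 * ℤ.∣ + G ℤ.* + f r ℤ.- + r ℤ.* D ∣ <⟨ bound ⟩
      r                ≤⟨ m≤m*n r G ⟩
      r * G            ≤⟨ m≤n*m (r * G) (suc p) ⟩
      suc p * (r * G)  ∎))
      where
      open ≤-Reasoning
      rearrange : ∀ a b c d → a ℤ.* b ℤ.+ (ℤ.- c) ℤ.* d ≡ b ℤ.* a ℤ.- d ℤ.* c
      rearrange = ℤ-Solver.solve-∀

n<2^n : ∀ n → n < 2 ^ n
n<2^n zero    = s≤s z≤n
n<2^n (suc n) = begin-strict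
  1 + n         <⟨ +-mono-≤-< (m^n>0 2 n) (n<2^n n) ⟩
  2 ^ n + 2 ^ n ≡⟨ cong (λ k → 2 ^ n + k) (+-identityʳ (2 ^ n)) ⟨
  2 ^ suc n     ∎
  where open ≤-Reasoning

-- Only blocks of length at least some large Λ are split off, so that at most r / Λ steps
-- cost C each; the remaining piece is at most Λ long.
bounded-growth⇒sublinear : ∀ ℓ .{{_ : NonZero ℓ}} m C B (e : Bool → ℕ → ℕ) →
  (∀ b r → e b r ≤ r * B) →
  (∀ b j r → m ≤ j → r ≤ 2 ^ j * ℓ → e b (2 ^ j * ℓ + r) ≤ C + e (not b) r) →
  ∀ c → ∃[ R ] (∀ b r → R ≤ r → c * e b r < r)
bounded-growth⇒sublinear ℓ m C B e trivial growth c =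
  -- Beyond this threshold the remaining piece, of cost at most `Λ * B`, contributes less than
  -- `r / 2` to `c * e b r`. The split blocks contribute at most `r / 2` because `2 * c * C ≤ Λ`.
  suc (2 * (c * Λ * B)) , λ b r R≤r → *-cancelˡ-< (2 * Λ) (c * e b r) r (begin-strict
    2 * Λ * (c * e b r)                       ≡⟨ l₁ Λ c (e b r) ⟩
    2 * c * (Λ * e b r)                       ≤⟨ *-monoʳ-≤ (2 * c) (linear r b r (small r)) ⟩
    2 * c * (r * C + Λ * (Λ * B))             ≡⟨ l₂ c r C Λ B ⟩
    r * (2 * c * C) + Λ * (2 * (c * Λ * B))   <⟨ +-mono-≤-< (*-monoʳ-≤ r large) (*-monoʳ-< Λ R≤r) ⟩
    r * Λ + Λ * r                             ≡⟨ l₃ r Λ ⟩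
    2 * Λ * r                                 ∎)
  where
  open ≤-Reasoning
  -- The first summand makes `Λ` at least `2 * c * C`, by `n < 2 ^ n`; the second makes `growth`
  -- applicable to every block split off.
  n = 2 * c * C + m
  Λ = 2 ^ n * ℓ
  instance
    Λ≢0 : NonZero Λ
    Λ≢0 = m*n≢0 (2 ^ n) ℓ {{m^n≢0 2 n}}
  l₁ : ∀ Λ c x → 2 * Λ * (c * x) ≡ 2 * c * (Λ * x)
  l₁ = solve-∀
  l₂ : ∀ c r C Λ B → 2 * c * (r * C + Λ * (Λ * B)) ≡ r * (2 * c * C) + Λ * (2 * (c * Λ * B))
  l₂ = solve-∀
  l₃ : ∀ r Λ → r * Λ + Λ * r ≡ 2 * Λ * r
  l₃ = solve-∀
  large : 2 * c * C ≤ Λ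
  large = ≤-trans (m≤m+n _ m) (≤-trans (<⇒≤ (n<2^n n)) (m≤m*n (2 ^ n) ℓ))
  scale : ∀ i → 2 ^ i * Λ ≡ 2 ^ (i + n) * ℓ
  scale i = trans (sym (*-assoc (2 ^ i) (2 ^ n) ℓ)) (cong (_* ℓ) (sym (^-distribˡ-+-* 2 i n)))
  small : ∀ r → r ≤ 2 ^ r * Λ
  small r = ≤-trans (<⇒≤ (n<2^n r)) (m≤m*n (2 ^ r) Λ)
  -- This is `e b r ≤ r * C / Λ + Λ * B` without division. Splitting off `2 ^ i * Λ` letters costs
  -- `C`, which is paid for by any `Λ` of them. The induction can start at `i = r`, by `small`.
  linear : ∀ i b r → r ≤ 2 ^ i * Λ → Λ * e b r ≤ r * C + Λ * (Λ * B)
  linear zero b r r≤ = ≤-trans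
    (*-monoʳ-≤ Λ (≤-trans (trivial b r) (*-monoˡ-≤ B (≤-trans r≤ (≤-reflexive (*-identityˡ Λ))))))
    (m≤n+m _ (r * C))
  linear (suc i) b r r≤ with r ≤? 2 ^ i * Λ
  ... | yes r≤′ = linear i b r r≤′
  ... | no  r≰  = begin
    Λ * e b r                                       ≡⟨ cong (λ s → Λ * e b s) r≡ ⟩
    Λ * e b (2 ^ (i + n) * ℓ + s)                   ≤⟨ *-monoʳ-≤ Λ (growth b (i + n) s m≤ s≤′) ⟩
    Λ * (C + e (not b) s)                           ≡⟨ *-distribˡ-+ Λ C _ ⟩
    Λ * C + Λ * e (not b) s
      ≤⟨ +-mono-≤ (*-monoˡ-≤ C (m≤n*m Λ (2 ^ i) {{m^n≢0 2 i}})) (linear i (not b) s s≤) ⟩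
    2 ^ i * Λ * C + (s * C + Λ * (Λ * B))           ≡⟨ l₄ (2 ^ i * Λ) C s (Λ * (Λ * B)) ⟩
    (2 ^ i * Λ + s) * C + Λ * (Λ * B)
      ≡⟨ cong (λ t → t * C + Λ * (Λ * B)) (m+[n∸m]≡n (≰⇒≥ r≰)) ⟩
    r * C + Λ * (Λ * B)                             ∎
    where
    s = r ∸ 2 ^ i * Λ
    r≡ : r ≡ 2 ^ (i + n) * ℓ + s
    r≡ = trans (sym (m+[n∸m]≡n (≰⇒≥ r≰))) (cong (_+ s) (scale i))
    s≤ : s ≤ 2 ^ i * Λ
    s≤ = m≤n+o⇒m∸n≤o r (2 ^ i * Λ) (≤-trans r≤ (≤-reflexive (double i Λ)))
    s≤′ = ≤-trans s≤ (≤-reflexive (scale i))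
    m≤ : m ≤ i + n
    m≤ = ≤-trans (m≤n+m m (2 * c * C)) (m≤n+m n i)
    l₄ : ∀ a C s x → a * C + (s * C + x) ≡ (a + s) * C + x
    l₄ = solve-∀

-- Discrepancy of the prefix counts

∣i+j+k∣≤ : ∀ i j k → ℤ.∣ i ℤ.+ j ℤ.+ k ∣ ≤ ℤ.∣ i ∣ + ℤ.∣ j ∣ + ℤ.∣ k ∣
∣i+j+k∣≤ i j k = ≤-trans (ℤ.∣i+j∣≤∣i∣+∣j∣ (i ℤ.+ j) k) (+-monoˡ-≤ ℤ.∣ k ∣ (ℤ.∣i+j∣≤∣i∣+∣j∣ i j))

-- The counts are abstract and the recurrence is assumed only from index `m` on, so that the results
-- can be instantiated at several base indices `m`.
module Discrepancy
  (ℓ K m : ℕ) (count : Bool → ℕ → ℕ)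
  (count-≤ : ∀ b r → count b r ≤ r)
  (count-split : ∀ b j r → r ≤ 2 ^ j * ℓ →
    ∃[ c ] (c ≤ K × count b (2 ^ j * ℓ + r) ≡ count b (2 ^ j * ℓ) + count (not b) r + c))
  (doubling : ∀ j → m ≤ j →
    blockSum count ℓ (3 + j) + 2 * blockSum count ℓ j ≡
    blockSum count ℓ (1 + j) + 2 * blockSum count ℓ (2 + j))
  where

  S : ℕ → ℕ
  S = blockSum count ℓ

  increment : ℕ → ℤ
  increment j = + S (2 + j) ℤ.- + S j

  increment-suc : ∀ j → m ≤ j → increment (suc j) ≡ + 2 ℤ.* increment j
  increment-suc j m≤j = begin
    + S (3 + j) ℤ.- + S (1 + j)
      ≡⟨ l₁ (+ S (3 + j)) (+ S (1 + j)) (+ S j) ⟩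
    + S (3 + j) ℤ.+ + 2 ℤ.* + S j ℤ.- + S (1 + j) ℤ.- + 2 ℤ.* + S j
      ≡⟨ cong (λ i → i ℤ.- + S (1 + j) ℤ.- + 2 ℤ.* + S j) doubling′ ⟩
    + S (1 + j) ℤ.+ + 2 ℤ.* + S (2 + j) ℤ.- + S (1 + j) ℤ.- + 2 ℤ.* + S j
      ≡⟨ l₂ (+ S (1 + j)) (+ S (2 + j)) (+ S j) ⟩
    + 2 ℤ.* (+ S (2 + j) ℤ.- + S j) ∎
    where
    open ≡-Reasoning
    l₁ : ∀ a b c → a ℤ.- b ≡ a ℤ.+ + 2 ℤ.* c ℤ.- b ℤ.- + 2 ℤ.* c
    l₁ = ℤ-Solver.solve-∀
    l₂ : ∀ a b c → a ℤ.+ + 2 ℤ.* b ℤ.- a ℤ.- + 2 ℤ.* c ≡ + 2 ℤ.* (b ℤ.- c)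
    l₂ = ℤ-Solver.solve-∀
    cast : ∀ a b → + (a + 2 * b) ≡ + a ℤ.+ + 2 ℤ.* + b
    cast a b = cong (λ i → + a ℤ.+ i) (ℤ.pos-* 2 b)
    doubling′ : + S (3 + j) ℤ.+ + 2 ℤ.* + S j ≡ + S (1 + j) ℤ.+ + 2 ℤ.* + S (2 + j)
    doubling′ = trans (sym (cast (S (3 + j)) (S j)))
                (trans (cong +_ (doubling j m≤j)) (cast (S (1 + j)) (S (2 + j))))

  increment-+ : ∀ k j → m ≤ j → increment (k + j) ≡ + (2 ^ k) ℤ.* increment j
  increment-+ zero    j m≤j = sym (ℤ.*-identityˡ (increment j))
  increment-+ (suc k) j m≤j = begin
    increment (suc k + j)                    ≡⟨ increment-suc (k + j) (≤-trans m≤j (m≤n+m j k)) ⟩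
    + 2 ℤ.* increment (k + j)                ≡⟨ cong (λ i → + 2 ℤ.* i) (increment-+ k j m≤j) ⟩
    + 2 ℤ.* (+ (2 ^ k) ℤ.* increment j)      ≡⟨ ℤ.*-assoc (+ 2) (+ (2 ^ k)) (increment j) ⟨
    + 2 ℤ.* + (2 ^ k) ℤ.* increment j        ≡⟨ cong (ℤ._* increment j) (ℤ.pos-* 2 (2 ^ k)) ⟨
    + (2 ^ suc k) ℤ.* increment j            ∎
    where open ≡-Reasoning

  -- The block of index `suc j` and its reflection consist of the same two halves in opposite
  -- orders, so both counts are `S j` up to straddling occurrences.
  count-double : ∀ b j → ∃[ c ] (c ≤ K × count b (2 ^ suc j * ℓ) ≡ S j + c)
  count-double b j = let c , c≤ , eq = count-split b j (2 ^ j * ℓ) ≤-refl in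
    c , c≤ , trans (cong (count b) (double j ℓ)) (trans eq (cong (_+ c) (flip b)))
    where
    flip : ∀ b → count b (2 ^ j * ℓ) + count (not b) (2 ^ j * ℓ) ≡ S j
    flip false = refl
    flip true  = +-comm (count true (2 ^ j * ℓ)) _

  S-double : ∀ j → ∃[ c ] (c ≤ 2 * K × S (suc j) ≡ 2 * S j + c)
  S-double j = let c , c≤ , eq = count-double false j
                   d , d≤ , eq′ = count-double true j in
    c + d , ≤-trans (+-mono-≤ c≤ d≤) (≤-reflexive (l₁ K)) , trans (cong₂ _+_ eq eq′) (l₂ (S j) c d)
    where
    l₁ : ∀ a → a + a ≡ 2 * a
    l₁ = solve-∀
    l₂ : ∀ a b c → a + b + (a + c) ≡ 2 * a + (b + c)
    l₂ = solve-∀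

  -- This ties the increment to the sum itself: `increment j` is `3 * S j` up to an error of at most
  -- `6 * K`.
  S-quadruple : ∀ j → ∃[ c ] (c ≤ 6 * K × S (2 + j) ≡ 4 * S j + c)
  S-quadruple j = let c , c≤ , eq = S-double (suc j)
                      d , d≤ , eq′ = S-double j in
    2 * d + c , ≤-trans (+-mono-≤ (*-monoʳ-≤ 2 d≤) c≤) (≤-reflexive (l₁ K)) ,
    trans eq (trans (cong (λ s → 2 * s + c) eq′) (l₂ (S j) c d))
    where
    l₁ : ∀ a → 2 * (2 * a) + 2 * a ≡ 6 * a
    l₁ = solve-∀
    l₂ : ∀ a b c → 2 * (2 * a + c) + b ≡ 4 * a + (2 * c + b)
    l₂ = solve-∀

  Λ : ℕ
  Λ = 2 ^ m * ℓ

  -- Scaled by 6 Λ, the denominator of d = increment m / (6 Λ), so as to be an integer.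
  discrepancy : Bool → ℕ → ℤ
  discrepancy b r = + (6 * Λ) ℤ.* + count b r ℤ.- + r ℤ.* increment m

  -- This crude bound is meant for the last piece, which is not split further.
  discrepancy-≤ : ∀ b r → ℤ.∣ discrepancy b r ∣ ≤ r * (6 * Λ + ℤ.∣ increment m ∣)
  discrepancy-≤ b r = begin
    ℤ.∣ discrepancy b r ∣
      ≤⟨ ℤ.∣i-j∣≤∣i∣+∣j∣ (+ (6 * Λ) ℤ.* + count b r) (+ r ℤ.* increment m) ⟩
    ℤ.∣ + (6 * Λ) ℤ.* + count b r ∣ + ℤ.∣ + r ℤ.* increment m ∣
      ≡⟨ cong₂ _+_ (ℤ.∣i*j∣≡∣i∣*∣j∣ (+ (6 * Λ)) (+ count b r))
                  (ℤ.∣i*j∣≡∣i∣*∣j∣ (+ r) (increment m)) ⟩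
    6 * Λ * count b r + r * ℤ.∣ increment m ∣
      ≤⟨ +-monoˡ-≤ _ (*-monoʳ-≤ (6 * Λ) (count-≤ b r)) ⟩
    6 * Λ * r + r * ℤ.∣ increment m ∣
      ≡⟨ l₁ (6 * Λ) r ℤ.∣ increment m ∣ ⟩
    r * (6 * Λ + ℤ.∣ increment m ∣) ∎
    where
    open ≤-Reasoning
    l₁ : ∀ a r d → a * r + r * d ≡ r * (a + d)
    l₁ = solve-∀

  -- With `j = k + m`, the count is `S j + c`, and `2 ^ suc k` times `increment m` is
  -- `2 * increment j`, that is, `6 * S j + 2 * d`. The terms `6 * S j` cancel and leave
  -- `(6 c - 2 d) Λ`, where `c ≤ K` and `d ≤ 6 * K`.
  discrepancy-block : ∀ b k → ℤ.∣ discrepancy b (2 ^ (suc k + m) * ℓ) ∣ ≤ 18 * K * Λ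
  discrepancy-block b k =
    let j = k + m
        c , c≤ , eq = count-double b j
        d , d≤ , eq′ = S-quadruple j in begin
    ℤ.∣ discrepancy b (2 ^ (suc k + m) * ℓ) ∣
      ≡⟨ cong ℤ.∣_∣ (exact c d eq eq′) ⟩
    ℤ.∣ (+ (6 * c) ℤ.- + (2 * d)) ℤ.* + Λ ∣
      ≡⟨ ℤ.∣i*j∣≡∣i∣*∣j∣ (+ (6 * c) ℤ.- + (2 * d)) (+ Λ) ⟩
    ℤ.∣ + (6 * c) ℤ.- + (2 * d) ∣ * Λ
      ≤⟨ *-monoˡ-≤ Λ (ℤ.∣i-j∣≤∣i∣+∣j∣ (+ (6 * c)) (+ (2 * d))) ⟩
    (6 * c + 2 * d) * Λ
      ≤⟨ *-monoˡ-≤ Λ (+-mono-≤ (*-monoʳ-≤ 6 c≤) (*-monoʳ-≤ 2 d≤)) ⟩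
    (6 * K + 2 * (6 * K)) * Λ
      ≡⟨ l₁ K Λ ⟩
    18 * K * Λ ∎
    where
    open ≤-Reasoning
    l₁ : ∀ K Λ → (6 * K + 2 * (6 * K)) * Λ ≡ 18 * K * Λ
    l₁ = solve-∀
    exact : ∀ c d → count b (2 ^ (suc k + m) * ℓ) ≡ S (k + m) + c →
      S (2 + (k + m)) ≡ 4 * S (k + m) + d →
      discrepancy b (2 ^ (suc k + m) * ℓ) ≡ (+ (6 * c) ℤ.- + (2 * d)) ℤ.* + Λ
    exact c d eq eq′ = E.begin
      + (6 * Λ) ℤ.* + count b (2 ^ (suc k + m) * ℓ) ℤ.- + (2 ^ (suc k + m) * ℓ) ℤ.* increment m
        E.≡⟨ cong₂ (λ i j → i ℤ.* + count b (2 ^ (suc k + m) * ℓ) ℤ.- j ℤ.* increment m)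
               (ℤ.pos-* 6 Λ) scale ⟩
      + 6 ℤ.* + Λ ℤ.* + count b (2 ^ (suc k + m) * ℓ) ℤ.- + 2 ℤ.* + (2 ^ k) ℤ.* + Λ ℤ.* increment m
        E.≡⟨ cong (λ i → + 6 ℤ.* + Λ ℤ.* + i ℤ.- + 2 ℤ.* + (2 ^ k) ℤ.* + Λ ℤ.* increment m) eq ⟩
      + 6 ℤ.* + Λ ℤ.* (+ s ℤ.+ + c) ℤ.- + 2 ℤ.* + (2 ^ k) ℤ.* + Λ ℤ.* increment m
        E.≡⟨ e₁ (+ Λ) (+ s) (+ c) (+ (2 ^ k)) (increment m) ⟩
      (+ 6 ℤ.* (+ s ℤ.+ + c) ℤ.- + 2 ℤ.* (+ (2 ^ k) ℤ.* increment m)) ℤ.* + Λ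
        E.≡⟨ cong (λ i → (+ 6 ℤ.* (+ s ℤ.+ + c) ℤ.- + 2 ℤ.* i) ℤ.* + Λ)
               (trans (sym (increment-+ k m ≤-refl)) increment≡) ⟩
      (+ 6 ℤ.* (+ s ℤ.+ + c) ℤ.- + 2 ℤ.* (+ 4 ℤ.* + s ℤ.+ + d ℤ.- + s)) ℤ.* + Λ
        E.≡⟨ e₂ (+ s) (+ c) (+ d) (+ Λ) ⟩
      (+ 6 ℤ.* + c ℤ.- + 2 ℤ.* + d) ℤ.* + Λ
        E.≡⟨ cong₂ (λ i j → (i ℤ.- j) ℤ.* + Λ) (ℤ.pos-* 6 c) (ℤ.pos-* 2 d) ⟨
      (+ (6 * c) ℤ.- + (2 * d)) ℤ.* + Λ E.∎
      where
      module E = ≡-Reasoning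
      s = S (k + m)
      increment≡ : increment (k + m) ≡ + 4 ℤ.* + s ℤ.+ + d ℤ.- + s
      increment≡ = cong (ℤ._- + s) (trans (cong +_ eq′) (cong (ℤ._+ + d) (ℤ.pos-* 4 s)))
      scale : + (2 ^ (suc k + m) * ℓ) ≡ + 2 ℤ.* + (2 ^ k) ℤ.* + Λ
      scale = trans (cong (λ i → + (i * ℓ)) (^-distribˡ-+-* 2 (suc k) m))
              (trans (cong +_ (*-assoc (2 ^ suc k) (2 ^ m) ℓ))
              (trans (ℤ.pos-* (2 ^ suc k) Λ) (cong (ℤ._* + Λ) (ℤ.pos-* 2 (2 ^ k)))))
      e₁ : ∀ L s c p i → + 6 ℤ.* L ℤ.* (s ℤ.+ c) ℤ.- + 2 ℤ.* p ℤ.* L ℤ.* i ≡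
                         (+ 6 ℤ.* (s ℤ.+ c) ℤ.- + 2 ℤ.* (p ℤ.* i)) ℤ.* L
      e₁ = ℤ-Solver.solve-∀
      e₂ : ∀ s c d L → (+ 6 ℤ.* (s ℤ.+ c) ℤ.- + 2 ℤ.* (+ 4 ℤ.* s ℤ.+ d ℤ.- s)) ℤ.* L ≡
                       (+ 6 ℤ.* c ℤ.- + 2 ℤ.* d) ℤ.* L
      e₂ = ℤ-Solver.solve-∀

  discrepancy-split : ∀ b k r → r ≤ 2 ^ (suc k + m) * ℓ →
    ℤ.∣ discrepancy b (2 ^ (suc k + m) * ℓ + r) ∣ ≤ 24 * K * Λ + ℤ.∣ discrepancy (not b) r ∣
  discrepancy-split b k r r≤ =
    let L = 2 ^ (suc k + m) * ℓ
        c , c≤ , eq = count-split b (suc k + m) r r≤ in begin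
    ℤ.∣ discrepancy b (L + r) ∣
      ≡⟨ cong (λ i → ℤ.∣ + (6 * Λ) ℤ.* + i ℤ.- + (L + r) ℤ.* increment m ∣) eq ⟩
    ℤ.∣ + (6 * Λ) ℤ.* (+ count b L ℤ.+ + count (not b) r ℤ.+ + c)
        ℤ.- (+ L ℤ.+ + r) ℤ.* increment m ∣
      ≡⟨ cong ℤ.∣_∣ (l₁ (+ (6 * Λ)) (+ count b L) (+ count (not b) r) (+ c) (+ L) (+ r) (increment m)) ⟩
    ℤ.∣ discrepancy b L ℤ.+ discrepancy (not b) r ℤ.+ + (6 * Λ) ℤ.* + c ∣
      ≤⟨ ∣i+j+k∣≤ (discrepancy b L) (discrepancy (not b) r) (+ (6 * Λ) ℤ.* + c) ⟩
    ℤ.∣ discrepancy b L ∣ + ℤ.∣ discrepancy (not b) r ∣ + ℤ.∣ + (6 * Λ) ℤ.* + c ∣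
      ≡⟨ cong (λ i → ℤ.∣ discrepancy b L ∣ + ℤ.∣ discrepancy (not b) r ∣ + i)
           (ℤ.∣i*j∣≡∣i∣*∣j∣ (+ (6 * Λ)) (+ c)) ⟩
    ℤ.∣ discrepancy b L ∣ + ℤ.∣ discrepancy (not b) r ∣ + 6 * Λ * c
      ≤⟨ +-mono-≤ (+-monoˡ-≤ _ (discrepancy-block b k)) (*-monoʳ-≤ (6 * Λ) c≤) ⟩
    -- The constant 24 is 18 from the block plus 6 from the straddling occurrences, which the
    -- scaling multiplies by `6 * Λ`.
    18 * K * Λ + ℤ.∣ discrepancy (not b) r ∣ + 6 * Λ * K
      ≡⟨ l₂ K Λ ℤ.∣ discrepancy (not b) r ∣ ⟩
    24 * K * Λ + ℤ.∣ discrepancy (not b) r ∣ ∎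
    where
    open ≤-Reasoning
    l₁ : ∀ g x y c L r i → g ℤ.* (x ℤ.+ y ℤ.+ c) ℤ.- (L ℤ.+ r) ℤ.* i ≡
                           (g ℤ.* x ℤ.- L ℤ.* i) ℤ.+ (g ℤ.* y ℤ.- r ℤ.* i) ℤ.+ g ℤ.* c
    l₁ = ℤ-Solver.solve-∀
    l₂ : ∀ K L e → 18 * K * L + e + 6 * L * K ≡ 24 * K * L + e
    l₂ = solve-∀

  discrepancy-sublinear : .{{_ : NonZero ℓ}} → ∀ c →
    ∃[ R ] (∀ b r → R ≤ r → c * ℤ.∣ discrepancy b r ∣ < r)
  -- The index starts at `suc m` because `discrepancy-block` compares a block with the sum one index
  -- earlier, which must be at least `m`.
  discrepancy-sublinear = bounded-growth⇒sublinear ℓ (suc m)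
    (24 * K * Λ) (6 * Λ + ℤ.∣ increment m ∣)
    (λ b r → ℤ.∣ discrepancy b r ∣) discrepancy-≤
    (λ b j r m<j r≤ → subst
       (λ i → r ≤ 2 ^ i * ℓ →
         ℤ.∣ discrepancy b (2 ^ i * ℓ + r) ∣ ≤ 24 * K * Λ + ℤ.∣ discrepancy (not b) r ∣)
       (trans (sym (+-suc (j ∸ suc m) m)) (m∸n+n≡m m<j))
       (discrepancy-split b (j ∸ suc m) r) r≤)

-- Existence and value of the density

/-cross : ∀ i j m n .{{_ : NonZero m}} .{{_ : NonZero n}} →
  i ℤ.* + n ≡ j ℤ.* + m → i / m ≡ j / n
/-cross i j (suc m) (suc n) eq = ℚ.fromℚᵘ-cong {mkℚᵘ i m} {mkℚᵘ j n} (ℚᵘ.*≡* eq)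

theorem1p4 :
  ∀ (M ℓ : ℕ) → .{{_ : NonZero M}} → .{{_ : NonZero ℓ}} →
  (w : Vec (Letter M) ℓ) (τ : Sequence M) → GeneratedBy w τ →
  (δ : Word M) → δ ≢ [] → δ OccursIn τ →
  ∃[ d ] ∃[ d′ ]
    (HasDensity τ δ d × HasDensity τ (reflect δ) d′ ×
     (∀ (n : ℕ) → 4 ^ n * ℓ ≥ length δ ∸ 1 →
        let N = occurrences δ (segment τ 0 (4 ^ n * ℓ))
              + occurrences (reflect δ) (segment τ 0 (4 ^ n * ℓ))
            P = occurrences δ (segment τ 0 (4 ^ (n + 1) * ℓ))
              + occurrences (reflect δ) (segment τ 0 (4 ^ (n + 1) * ℓ))
        in d ≡ d′ × d′ ≡ _/_ (+ P ℤ.- + N) (6 * 4 ^ n * ℓ) {{6*4^n*ℓ≢0 n ℓ}}))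
theorem1p4 M ℓ w τ gen δ δ≢[] _ =
  d , d , density , density-reflect , λ n long → refl , formula n long
  where
  open ≡-Reasoning
  count = prefixCount gen δ

  doubling : ∀ m → length δ ∸ 1 ≤ 2 ^ m * ℓ → ∀ j → m ≤ j →
    let S = blockSum count ℓ in S (3 + j) + 2 * S j ≡ S (1 + j) + 2 * S (2 + j)
  doubling m long j m≤j =
    prefixCount-doubling gen δ j (≤-trans long (*-monoˡ-≤ ℓ (^-monoʳ-≤ 2 m≤j)))

  module Base m (long : length δ ∸ 1 ≤ 2 ^ m * ℓ) =
    Discrepancy ℓ (length δ) m count (prefixCount-≤ gen δ δ≢[]) (prefixCount-split gen δ δ≢[])
      (doubling m long)

  -- Any index whose block has length at least `length δ ∸ 1` would do; this one qualifies by
  -- `m < 2 ^ m`.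
  m = length δ
  longᵐ : length δ ∸ 1 ≤ 2 ^ m * ℓ
  longᵐ = ≤-trans (m∸n≤m m 1) (≤-trans (<⇒≤ (n<2^n m)) (m≤m*n (2 ^ m) ℓ))
  open Base m longᵐ

  instance
    G≢0 : NonZero (6 * Λ)
    G≢0 = m*n≢0 6 Λ {{_}} {{m*n≢0 (2 ^ m) ℓ {{m^n≢0 2 m}}}}

  d : ℚ
  d = increment m / (6 * Λ)

  reflected : ∀ r → occurrences (reflect δ) (segment τ 0 r) ≡ count true r
  reflected r = trans (sym (occurrences-reflect (reflect δ) (reflect-≢[] δ≢[]) (segment τ 0 r)))
                      (cong (λ ε → occurrences ε (reflect (segment τ 0 r))) (reflect-involutive δ))

  density : HasDensity τ δ d
  density = sublinear⇒⟶ (count false) (6 * Λ) (increment m) λ c →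
    let R , small = discrepancy-sublinear c in R , small false

  density-reflect : HasDensity τ (reflect δ) d
  density-reflect = sublinear⇒⟶ (λ r → occurrences (reflect δ) (segment τ 0 r))
    (6 * Λ) (increment m) λ c →
    let R , small = discrepancy-sublinear c in R , λ r R≤r →
      subst (λ o → c * ℤ.∣ + (6 * Λ) ℤ.* + o ℤ.- + r ℤ.* increment m ∣ < r)
        (sym (reflected r)) (small true r R≤r)

  sum : ℕ → ℕ
  sum r = occurrences δ (segment τ 0 r) + occurrences (reflect δ) (segment τ 0 r)

  -- After cross-multiplication the claim is that `2 ^ k` times `increment m` equals `2 ^ m` times
  -- `increment k`. Both are `increment (m + k)`, computed from base `m` and from base `k`, so the
  -- two indices need not be compared.
  formula : ∀ n → length δ ∸ 1 ≤ 4 ^ n * ℓ →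
    d ≡ _/_ (+ sum (4 ^ (n + 1) * ℓ) ℤ.- + sum (4 ^ n * ℓ))
            (6 * 4 ^ n * ℓ) {{6*4^n*ℓ≢0 n ℓ}}
  formula n long = /-cross (increment m)
    (+ sum (4 ^ (n + 1) * ℓ) ℤ.- + sum (4 ^ n * ℓ)) (6 * Λ) (6 * 4 ^ n * ℓ) {{_}} {{6*4^n*ℓ≢0 n ℓ}} (begin
    increment m ℤ.* + (6 * 4 ^ n * ℓ)
      ≡⟨ cong (λ i → increment m ℤ.* i) (trans (cong (λ q → + (6 * q * ℓ)) (power n)) (cast (2 ^ k))) ⟩
    increment m ℤ.* (+ 6 ℤ.* + (2 ^ k) ℤ.* + ℓ)
      ≡⟨ l₁ (increment m) (+ (2 ^ k)) (+ ℓ) ⟩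
    + (2 ^ k) ℤ.* increment m ℤ.* (+ 6 ℤ.* + ℓ)
      ≡⟨ cong (ℤ._* (+ 6 ℤ.* + ℓ)) (increment-+ k m ≤-refl) ⟨
    increment (k + m) ℤ.* (+ 6 ℤ.* + ℓ)
      ≡⟨ cong (λ i → increment i ℤ.* (+ 6 ℤ.* + ℓ)) (+-comm k m) ⟩
    increment (m + k) ℤ.* (+ 6 ℤ.* + ℓ)
      ≡⟨ cong (ℤ._* (+ 6 ℤ.* + ℓ)) (Base.increment-+ k long′ m k ≤-refl) ⟩
    + (2 ^ m) ℤ.* increment k ℤ.* (+ 6 ℤ.* + ℓ)
      ≡⟨ l₁ (increment k) (+ (2 ^ m)) (+ ℓ) ⟨
    increment k ℤ.* (+ 6 ℤ.* + (2 ^ m) ℤ.* + ℓ)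
      ≡⟨ cong (λ i → increment k ℤ.* i) (trans (cong +_ (sym (*-assoc 6 (2 ^ m) ℓ))) (cast (2 ^ m))) ⟨
    increment k ℤ.* + (6 * Λ)
      ≡⟨ cong (ℤ._* + (6 * Λ)) (cong₂ (λ P N → + P ℤ.- + N) (sum≡ (2 + k)) (sum≡ k)) ⟨
    (+ sum (2 ^ (2 + k) * ℓ) ℤ.- + sum (2 ^ k * ℓ)) ℤ.* + (6 * Λ)
      ≡⟨ cong₂ (λ p q → (+ sum (p * ℓ) ℤ.- + sum (q * ℓ)) ℤ.* + (6 * Λ)) power-suc (power n) ⟨
    (+ sum (4 ^ (n + 1) * ℓ) ℤ.- + sum (4 ^ n * ℓ)) ℤ.* + (6 * Λ) ∎)
    where
    -- Since `4 ^ n = 2 ^ (2 * n)`, one factor 4 advances the block index by two, and `P - N` is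
    -- `increment k`.
    k = 2 * n
    power : ∀ n → 4 ^ n ≡ 2 ^ (2 * n)
    power n = ^-*-assoc 2 2 n
    power-suc : 4 ^ (n + 1) ≡ 2 ^ (2 + k)
    power-suc = trans (power (n + 1)) (cong (2 ^_) (l₂ n))
      where
      l₂ : ∀ n → 2 * (n + 1) ≡ 2 + 2 * n
      l₂ = solve-∀
    long′ : length δ ∸ 1 ≤ 2 ^ k * ℓ
    long′ = subst (λ q → length δ ∸ 1 ≤ q * ℓ) (power n) long
    cast : ∀ q → + (6 * q * ℓ) ≡ + 6 ℤ.* + q ℤ.* + ℓ
    cast q = trans (ℤ.pos-* (6 * q) ℓ) (cong (ℤ._* + ℓ) (ℤ.pos-* 6 q))
    sum≡ : ∀ i → sum (2 ^ i * ℓ) ≡ count false (2 ^ i * ℓ) + count true (2 ^ i * ℓ)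
    sum≡ i = cong (λ o → count false (2 ^ i * ℓ) + o) (reflected (2 ^ i * ℓ))
    l₁ : ∀ i p l → i ℤ.* (+ 6 ℤ.* p ℤ.* l) ≡ p ℤ.* i ℤ.* (+ 6 ℤ.* l)
    l₁ = ℤ-Solver.solve-∀
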